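{- The expected values $E_N^{lin-exp}$ and $E_N^{lin-exp-sym}$ of the $N$th exponential linear complexity and of its symmetric version satisfy $$E_N^{lin-exp-sym}\le E_N^{lin-exp}-\frac{3N}{4}+O(1).$$ That is, there is an absolute constant $C$ such that $E_N^{lin-exp-sym}\le E_N^{lin-exp}-\frac{3N}{4}+C$ for all positive integers $N$.
   Context: For a binary vector $\mathcal{S}_N=(s_0,\ldots,s_{N-1})\in\{0,1\}^N$, regarded over the field $\mathbb{F}_2$, the $N$th linear complexity $L(\mathcal{S}_N)$ is the smallest integer $L\ge 0$ for which there are $c_0,\ldots,c_L\in\mathbb{F}_2$ with $c_L=1$ such that $$\sum_{\ell=0}^L c_\ell s_{n+\ell}=0,\quad n=0,1,\ldots,N-L-1$$ (the condition is vacuous for $L=N$; the zero vector has $L=0$). The reverse of $\mathcal{S}_N$ is $\mathcal{S}_N^{rev}=(s_{N-1},s_{N-2},\ldots,s_0)$ and the $N$th symmetric linear complexity is $L^{sym}(\mathcal{S}_N)=\min\{L(\mathcal{S}_N),L(\mathcal{S}_N^{rev})\}$. The expected values are $$E_N^{lin-exp}=2^{ -N}\sum_{\mathcal{S}_N\in\{0,1\}^N}2^{L(\mathcal{S}_N)},\qquad E_N^{lin-exp-sym}=2^{ -N}\sum_{\mathcal{S}_N\in\{0,1\}^N}2^{L^{sym}(\mathcal{S}_N)}.$$ -}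

module Defs where

open import Algebra.Bundles using (CommutativeRing)
open import Data.Bool.Properties using (xor-∧-commutativeRing)
import Data.Bool.Properties as Bool
open import Data.Fin.Base using (Fin; toℕ; fromℕ<)
import Data.Fin.Properties as Fin
open import Data.Fin.Subset.Properties using (anySubset?)
open import Data.Integer.Base using (+_)
open import Data.List.Base as List using (List; _++_)
open import Data.Nat.Base using (ℕ; zero; suc; _+_; _<_; _∸_; _^_; _⊓_; s<s⁻¹; s≤s⁻¹)
open import Data.Nat.ListAction using (sum)
import Data.Nat.Properties as ℕ
open import Data.Product.Base using (∃; Σ-syntax; _×_; _,_; proj₁)
open import Data.Rational.Base using (ℚ; _/_)
open import Data.Vec.Base using (Vec; []; _∷_; lookup; last; replicate; _∷ʳ_; reverse)
import Data.Vec.Properties as Vec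
open import Function.Base using (_∘_)
open import Level using (0ℓ)
open import Relation.Binary.PropositionalEquality using (_≡_; subst)
open import Relation.Nullary.Decidable using (yes; no; _×-dec_)
open import Relation.Nullary.Negation using (¬_; contradiction)
open import Relation.Unary using (Pred; Decidable)

open CommutativeRing xor-∧-commutativeRing
  using (_*_; 0#; 1#; +-commutativeMonoid)
  renaming (Carrier to 𝔽₂)
open import Algebra.Properties.CommutativeMonoid.Sum +-commutativeMonoid
  using (sum⁺-syntax)

private
  variable
    N : ℕ

shift-< : ∀ {L} (n : Fin (N ∸ L)) (ℓ : Fin (suc L)) → toℕ n + toℕ ℓ < N
shift-< {N} {L} n ℓ = ℕ.≤-<-trans
  (ℕ.+-monoʳ-≤ (toℕ n) (s≤s⁻¹ (Fin.toℕ<n ℓ)))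
  (ℕ.m≤o∸n⇒m+n≤o (suc (toℕ n)) (ℕ.<⇒≤ L<N) n<N∸L)
  where
  n<N∸L : toℕ n < N ∸ L
  n<N∸L = Fin.toℕ<n n

  L<N : L < N
  L<N = ℕ.m∸n≢0⇒n<m (ℕ.m<n⇒n≢0 n<N∸L)

-- The position n + ℓ, for 0 ≤ n ≤ N - L - 1 and 0 ≤ ℓ ≤ L.  When L ≥ N there
-- is no such n, since N ∸ L = 0.

shift : ∀ {L} → Fin (N ∸ L) → Fin (suc L) → Fin N
shift n ℓ = fromℕ< (shift-< n ℓ)

Annihilates : ∀ {L} → Vec 𝔽₂ (suc L) → Vec 𝔽₂ N → Set
Annihilates {N} {L} c s =
  ∀ (n : Fin (N ∸ L)) → ∑[ ℓ ≤ L ] (lookup c ℓ * lookup s (shift n ℓ)) ≡ 0#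

HasRecurrence : Vec 𝔽₂ N → ℕ → Set
HasRecurrence s L = Σ[ c ∈ Vec 𝔽₂ (suc L) ] last c ≡ 1# × Annihilates c s

-- Subset n is Vec Bool n, so anySubset? searches all coefficient vectors.

hasRecurrence? : (s : Vec 𝔽₂ N) → Decidable (HasRecurrence s)
hasRecurrence? s L = anySubset? λ c →
  (last c Bool.≟ 1#) ×-dec Fin.all? λ n → _ Bool.≟ _

hasRecurrence-length : (s : Vec 𝔽₂ N) → HasRecurrence s N
hasRecurrence-length {N} s =
  replicate N 0# ∷ʳ 1# , Vec.last-∷ʳ 1# (replicate N 0#) ,
  λ n → contradiction (subst Fin (ℕ.n∸n≡0 N) n) Fin.¬Fin0

IsLeast : Pred ℕ 0ℓ → ℕ → Set
IsLeast P m = P m × (∀ {k} → k < m → ¬ P k)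

least : ∀ {P : Pred ℕ 0ℓ} → Decidable P → ∀ n → P n → ∃ (IsLeast P)
least P? zero Pn = 0 , Pn , λ ()
least {P} P? (suc n) Pn with P? 0
... | yes P0 = 0 , P0 , λ ()
... | no ¬P0 with least (P? ∘ suc) n Pn
...   | m , Pm , below = suc m , Pm , below′
  where
  below′ : ∀ {k} → k < suc m → ¬ P k
  below′ {zero}  _   = ¬P0
  below′ {suc k} k<m = below (s<s⁻¹ k<m)

leastRecurrence : (s : Vec 𝔽₂ N) → ∃ (IsLeast (HasRecurrence s))
leastRecurrence {N} s = least (hasRecurrence? s) N (hasRecurrence-length s)

linearComplexity : Vec 𝔽₂ N → ℕ
linearComplexity s = proj₁ (leastRecurrence s)

symLinearComplexity : Vec 𝔽₂ N → ℕ
symLinearComplexity s = linearComplexity s ⊓ linearComplexity (reverse s)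

-- Each binary vector of length N occurs exactly once.

binaryVectors : ∀ N → List (Vec 𝔽₂ N)
binaryVectors zero    = List.[ [] ]
binaryVectors (suc N) =
  List.map (0# ∷_) (binaryVectors N) ++ List.map (1# ∷_) (binaryVectors N)

-- The expected value of 2 ^ f over the uniform distribution.

expectedExp : ∀ N → (Vec 𝔽₂ N → ℕ) → ℚ
expectedExp N f =
  (+ sum (List.map (λ s → 2 ^ f s) (binaryVectors N)) / (2 ^ N)) {{ℕ.m^n≢0 2 N}}

E-lin-exp : ℕ → ℚ
E-lin-exp N = expectedExp N linearComplexity

E-lin-exp-sym : ℕ → ℚ
E-lin-exp-sym N = expectedExp N symLinearComplexity

{-# OPTIONS --safe #-}
module Submission where

-- Let s begin with a run of exactly p equal entries b, followed by m = N - p ≥ 1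
-- entries.  The first change at position p forces L(s) ≥ p + 1 if b = 0 and
-- L(s) ≥ p if b = 1, while the reverse of s ends with the run and so is
-- annihilated by x^m if b = 0 and by x^m (x + 1) if b = 1.  For each m ≤ N/2 the
-- 2^(m-1) vectors of either kind contribute 1 - 2^(2m-1-N), respectively
-- 1/2 - 2^(2m-N), to the difference of the expected values.  The negative parts
-- have bounded sums, which leaves N/2 + N/4 - O(1).

open import Defs
open import Algebra.Bundles using (CommutativeMonoid; CommutativeRing)
open import Data.Bool.Base using (false; true; not; if_then_else_)
open import Data.Bool.Properties using (xor-∧-commutativeRing)
import Data.Bool.Properties as Bool
open import Data.Fin.Base using (Fin; zero; suc; toℕ; fromℕ; fromℕ<; inject₁; opposite)
import Data.Fin.Properties as Fin
open import Data.Integer.Base as ℤ using (+_; +≤+)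
import Data.Integer.Properties as ℤ
open import Data.List.Base as List using (_++_)
import Data.List.Properties as List
open import Data.Nat.Base as ℕ using (ℕ; NonZero)
open import Data.Nat.ListAction using (sum)
open import Data.Nat.ListAction.Properties using (sum-++)
import Data.Nat.Properties as ℕ
open import Data.Nat.Tactic.RingSolver using (solve-∀)
open import Data.Product.Base using (Σ-syntax; ∃-syntax; _×_; _,_; proj₁; proj₂)
open import Data.Rational.Base as ℚ using (ℚ; _/_; _+_; _-_; _≤_; toℚᵘ)
import Data.Rational.Properties as ℚ
open import Data.Rational.Unnormalised.Base as ℚᵘ using (mkℚᵘ; _≃_; *≤*)
import Data.Rational.Unnormalised.Properties as ℚᵘ
open import Data.Sum.Base using (_⊎_; inj₁; inj₂)
open import Data.Vec.Base
  using (Vec; []; _∷_; _∷ʳ_; lookup; replicate; reverse; initLast)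
import Data.Vec.Properties as Vec
open import Function.Base using (_∘_)
open import Relation.Binary.PropositionalEquality
  using (_≡_; refl; sym; trans; cong; cong₂; subst; module ≡-Reasoning)
open import Relation.Nullary.Decidable using (does; yes; no)
open import Relation.Nullary.Negation using (contradiction)

open CommutativeRing xor-∧-commutativeRing
  using (0#; 1#; +-commutativeMonoid; semiring; zeroʳ)
  renaming (Carrier to 𝔽₂; _+_ to _⊕_; _*_ to _⊗_; +-identityʳ to ⊕-identityʳ)
open import Algebra.Properties.CommutativeMonoid.Sum +-commutativeMonoid
  using (sum-syntax; sum-init-last; sum-cong-≗; sum-replicate-zero)
  renaming (sum to ∑)
open import Algebra.Properties.CommutativeSemigroup ℕ.+-commutativeSemigroup
  using (interchange)
open import Algebra.Properties.CommutativeSemigroup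
  (CommutativeMonoid.commutativeSemigroup ℚ.+-0-commutativeMonoid) using (xy∙z≈xz∙y)
open import Algebra.Properties.Group ℚ.+-0-group using (//-rightDividesʳ)
open import Algebra.Properties.Semiring.Sum semiring using (*-distribʳ-sum)

private
  variable
    A : Set
    b : 𝔽₂
    L N n : ℕ

-- Entries of extended and reversed vectors, and sums against them.

lookup-∷ʳ-inject₁ : ∀ (xs : Vec A n) x i → lookup (xs ∷ʳ x) (inject₁ i) ≡ lookup xs i
lookup-∷ʳ-inject₁ (_ ∷ _)  x zero    = refl
lookup-∷ʳ-inject₁ (_ ∷ xs) x (suc i) = lookup-∷ʳ-inject₁ xs x i

lookup-∷ʳ-fromℕ : ∀ (xs : Vec A n) x → lookup (xs ∷ʳ x) (fromℕ n) ≡ x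
lookup-∷ʳ-fromℕ []       x = refl
lookup-∷ʳ-fromℕ (_ ∷ xs) x = lookup-∷ʳ-fromℕ xs x

lookup-reverse-opposite : ∀ (xs : Vec A n) i → lookup (reverse xs) (opposite i) ≡ lookup xs i
lookup-reverse-opposite (x ∷ xs) zero
  rewrite Vec.reverse-∷ x xs = lookup-∷ʳ-fromℕ (reverse xs) x
lookup-reverse-opposite (x ∷ xs) (suc i)
  rewrite Vec.reverse-∷ x xs =
  trans (lookup-∷ʳ-inject₁ (reverse xs) x (opposite i)) (lookup-reverse-opposite xs i)

lookup-reverse : ∀ (xs : Vec A n) i → lookup (reverse xs) i ≡ lookup xs (opposite i)
lookup-reverse xs i = trans
  (cong (lookup (reverse xs)) (sym (Fin.opposite-involutive i)))
  (lookup-reverse-opposite xs (opposite i))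

∑-∷ʳ : ∀ (c : Vec 𝔽₂ n) x (y : Fin (ℕ.suc n) → 𝔽₂) →
  ∑[ i < ℕ.suc n ] (lookup (c ∷ʳ x) i ⊗ y i) ≡
  ∑[ i < n ] (lookup c i ⊗ y (inject₁ i)) ⊕ (x ⊗ y (fromℕ n))
∑-∷ʳ {n} c x y = trans
  (sum-init-last λ i → lookup (c ∷ʳ x) i ⊗ y i)
  (cong₂ _⊕_
    (sum-cong-≗ λ i → cong (_⊗ y (inject₁ i)) (lookup-∷ʳ-inject₁ c x i))
    (cong (_⊗ y (fromℕ n)) (lookup-∷ʳ-fromℕ c x)))

∑-replicate-0 : ∀ n (y : Fin n → 𝔽₂) → ∑[ i < n ] (lookup (replicate n 0#) i ⊗ y i) ≡ 0#
∑-replicate-0 n y = trans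
  (sum-cong-≗ λ i → cong (_⊗ y i) (Vec.lookup-replicate i 0#))
  (sum-replicate-zero n)

toℕ-shift : (n : Fin (N ℕ.∸ L)) (ℓ : Fin (ℕ.suc L)) → toℕ (shift n ℓ) ≡ toℕ n ℕ.+ toℕ ℓ
toℕ-shift n ℓ = Fin.toℕ-fromℕ< (shift-< n ℓ)

-- Recurrences of vectors with a constant initial or final run.

ConstantBelow : 𝔽₂ → ℕ → Vec 𝔽₂ N → Set
ConstantBelow b p s = ∀ i → toℕ i ℕ.< p → lookup s i ≡ b

ConstantFrom : 𝔽₂ → ℕ → Vec 𝔽₂ N → Set
ConstantFrom b m s = ∀ i → m ℕ.≤ toℕ i → lookup s i ≡ b

-- Entry i of the reversal is entry `opposite i` of `s`, which lies in the run once i exceeds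
-- `opposite p`. The starting index is N - p, the number of entries outside the run.
reverse-constant : ∀ (s : Vec 𝔽₂ N) (p : Fin N) →
  ConstantBelow b (toℕ p) s → ConstantFrom b (ℕ.suc (toℕ (opposite p))) (reverse s)
reverse-constant {N} s p below i p′<i = trans (lookup-reverse s i) (below (opposite i)
  (begin-strict
    toℕ (opposite i)            ≡⟨ Fin.opposite-prop i ⟩
    N ℕ.∸ ℕ.suc (toℕ i)         <⟨ ℕ.∸-monoʳ-< (ℕ.s≤s p′<i) (Fin.toℕ<n i) ⟩
    N ℕ.∸ ℕ.suc (toℕ (opposite p)) ≡⟨ Fin.opposite-prop (opposite p) ⟨
    toℕ (opposite (opposite p)) ≡⟨ cong toℕ (Fin.opposite-involutive p) ⟩
    toℕ p                       ∎))
  where open ℕ.≤-Reasoning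

-- Take the recurrence at n = p - L, so that the window ends exactly at p. Its other entries lie in
-- the run and equal b, so b factors out and only the sum of the lower coefficients matters.
recurrence-window : ∀ (s : Vec 𝔽₂ N) (c : Vec 𝔽₂ L) (p : Fin N) →
  Annihilates (c ∷ʳ 1#) s → ConstantBelow b (toℕ p) s → L ℕ.≤ toℕ p →
  (∑ (lookup c) ⊗ b) ⊕ lookup s p ≡ 0#
recurrence-window {N} {L} {b} s c p ann below L≤p = begin
  (∑ (lookup c) ⊗ b) ⊕ lookup s p
    ≡⟨ cong₂ _⊕_
         (trans (*-distribʳ-sum b (lookup c))
           (sum-cong-≗ λ i → cong (lookup c i ⊗_) (sym (below _ (start+<p i)))))
         (cong (lookup s) (Fin.toℕ-injective (sym end≡p))) ⟩
  ∑[ i < L ] (lookup c i ⊗ lookup s (shift start (inject₁ i))) ⊕ lookup s (shift start (fromℕ L))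
    ≡⟨ ∑-∷ʳ c 1# (λ i → lookup s (shift start i)) ⟨
  ∑[ i < ℕ.suc L ] (lookup (c ∷ʳ 1#) i ⊗ lookup s (shift start i))
    ≡⟨ ann start ⟩
  0# ∎
  where
  open ≡-Reasoning
  start : Fin (N ℕ.∸ L)
  start = fromℕ< (ℕ.∸-monoˡ-< (Fin.toℕ<n p) L≤p)

  toℕ-start+L : toℕ start ℕ.+ L ≡ toℕ p
  toℕ-start+L = trans (cong (ℕ._+ L) (Fin.toℕ-fromℕ< _)) (ℕ.m∸n+n≡m L≤p)

  end≡p : toℕ (shift start (fromℕ L)) ≡ toℕ p
  end≡p = trans (toℕ-shift start (fromℕ L))
    (trans (cong (toℕ start ℕ.+_) (Fin.toℕ-fromℕ L)) toℕ-start+L)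

  start+<p : ∀ i → toℕ (shift start (inject₁ i)) ℕ.< toℕ p
  start+<p i = subst (toℕ (shift start (inject₁ i)) ℕ.<_) toℕ-start+L
    (subst (ℕ._< toℕ start ℕ.+ L) (sym (toℕ-shift start (inject₁ i)))
      (ℕ.+-monoʳ-< (toℕ start) (subst (ℕ._< L) (sym (Fin.toℕ-inject₁ i)) (Fin.toℕ<n i))))

hasRecurrence-∷ʳ : (s : Vec 𝔽₂ N) → HasRecurrence s L → ∃[ c ] Annihilates {L = L} (c ∷ʳ 1#) s
hasRecurrence-∷ʳ s (c , last≡1 , ann) with initLast c | last≡1
... | c′ , _ , refl | refl = c′ , ann

-- If L ≤ p, the window ending at p consists of zeros followed by the first one, and the leading
-- coefficient 1 makes the sum 1.
run-0-recurrence : ∀ (s : Vec 𝔽₂ N) (p : Fin N) → ConstantBelow 0# (toℕ p) s →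
  lookup s p ≡ 1# → HasRecurrence s L → toℕ p ℕ.< L
run-0-recurrence s p below sp≡1 rec = ℕ.≰⇒> λ L≤p → contradiction
  (trans (sym (recurrence-window s c p ann below L≤p))
    (trans (cong (_⊕ lookup s p) (zeroʳ (∑ (lookup c)))) sp≡1))
  λ ()
  where
  c = proj₁ (hasRecurrence-∷ʳ s rec)
  ann = proj₂ (hasRecurrence-∷ʳ s rec)

-- The windows ending at p - 1 and at p differ only in their last entry.
run-1-recurrence : ∀ (s : Vec 𝔽₂ N) (p : Fin N) → ConstantBelow 1# (toℕ p) s →
  lookup s p ≡ 0# → HasRecurrence s L → toℕ p ℕ.≤ L
run-1-recurrence s zero    below sp≡0 rec = ℕ.z≤n
run-1-recurrence {N} {L} s p@(suc q) below sp≡0 rec = ℕ.≮⇒≥ λ L<p → contradiction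
  (trans (sym (window (inject₁ q)
            (λ i i<q → below i (ℕ.m<n⇒m<1+n (subst (toℕ i ℕ.<_) q≡ i<q)))
            (subst (L ℕ.≤_) (sym q≡) (ℕ.s≤s⁻¹ L<p))
            (below (inject₁ q) (ℕ.s≤s (ℕ.≤-reflexive q≡)))))
    (cong (_⊕ 1#) (trans (sym (⊕-identityʳ (∑ (lookup c) ⊗ 1#))) (window p below (ℕ.<⇒≤ L<p) sp≡0))))
  λ ()
  where
  q≡ : toℕ (inject₁ q) ≡ toℕ q
  q≡ = Fin.toℕ-inject₁ q
  c = proj₁ (hasRecurrence-∷ʳ s rec)
  ann = proj₂ (hasRecurrence-∷ʳ s rec)

  window : ∀ r → ConstantBelow 1# (toℕ r) s → L ℕ.≤ toℕ r → ∀ {x} → lookup s r ≡ x →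
    (∑ (lookup c) ⊗ 1#) ⊕ x ≡ 0#
  window r below L≤r sr≡x =
    trans (cong ((∑ (lookup c) ⊗ 1#) ⊕_) (sym sr≡x)) (recurrence-window s c r ann below L≤r)

-- The polynomial x^m only sees the last entry of each window, whose index is at least m.
tail-0-recurrence : ∀ (s : Vec 𝔽₂ N) m → ConstantFrom 0# m s → HasRecurrence s m
tail-0-recurrence s m from = replicate m 0# ∷ʳ 1# , Vec.last-∷ʳ 1# (replicate m 0#) , λ n →
  trans (∑-∷ʳ (replicate m 0#) 1# (lookup s ∘ shift n))
    (cong₂ _⊕_ (∑-replicate-0 m _)
      (from _ (subst (m ℕ.≤_) (sym (toℕ-shift n (fromℕ m)))
        (ℕ.≤-trans (ℕ.≤-reflexive (sym (Fin.toℕ-fromℕ m))) (ℕ.m≤n+m _ (toℕ n))))))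

-- For x^(m+1) + x^m, the last two entries of each window both lie in the tail of ones and cancel.
tail-1-recurrence : ∀ (s : Vec 𝔽₂ N) m → ConstantFrom 1# m s → HasRecurrence s (ℕ.suc m)
tail-1-recurrence s m from =
  replicate m 0# ∷ʳ 1# ∷ʳ 1# , Vec.last-∷ʳ 1# (replicate m 0# ∷ʳ 1#) , λ n →
  trans (∑-∷ʳ (replicate m 0# ∷ʳ 1#) 1# (lookup s ∘ shift n))
    (cong₂ _⊕_
      (trans (∑-∷ʳ (replicate m 0#) 1# (lookup s ∘ shift n ∘ inject₁))
        (cong₂ _⊕_ (∑-replicate-0 m _)
          (at n (inject₁ (fromℕ m)) (ℕ.≤-reflexive
            (sym (trans (Fin.toℕ-inject₁ (fromℕ m)) (Fin.toℕ-fromℕ m)))))))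
      (at n (fromℕ (ℕ.suc m)) (ℕ.m≤n⇒m≤1+n (ℕ.≤-reflexive (sym (Fin.toℕ-fromℕ m))))))
  where
  at : ∀ n ℓ → m ℕ.≤ toℕ ℓ → lookup s (shift n ℓ) ≡ 1#
  at n ℓ m≤ℓ = from _ (subst (m ℕ.≤_) (sym (toℕ-shift n ℓ))
    (ℕ.≤-trans m≤ℓ (ℕ.m≤n+m _ (toℕ n))))

hasRecurrence-linearComplexity : (s : Vec 𝔽₂ N) → HasRecurrence s (linearComplexity s)
hasRecurrence-linearComplexity s = proj₁ (proj₂ (leastRecurrence s))

linearComplexity-≤ : (s : Vec 𝔽₂ N) → HasRecurrence s L → linearComplexity s ℕ.≤ L
linearComplexity-≤ s rec = ℕ.≮⇒≥ λ L<lc → proj₂ (proj₂ (leastRecurrence s)) L<lc rec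

-- Summation over binary vectors according to the first change.

constantBelow-∷ : {xs : Vec 𝔽₂ n} {p : ℕ} → ConstantBelow b p xs → ConstantBelow b (ℕ.suc p) (b ∷ xs)
constantBelow-∷ below zero    _   = refl
constantBelow-∷ below (suc i) i<p = below i (ℕ.s<s⁻¹ i<p)

-- H applied to the number of entries after the first one that differs from b.
afterRun : 𝔽₂ → (ℕ → ℕ) → Vec 𝔽₂ n → ℕ
afterRun b H [] = 0
afterRun {ℕ.suc n} b H (x ∷ xs) = if does (x Bool.≟ b) then afterRun b H xs else H n

-- The first alternative covers the vector with all entries b, where the default 0 claims no gain.
-- Otherwise p is the first change, and `opposite p` counts the entries after it.
afterRun-cases : ∀ b H (xs : Vec 𝔽₂ n) → afterRun b H xs ≡ 0 ⊎
  ∃[ p ] ConstantBelow b (toℕ p) xs × lookup xs p ≡ not b × afterRun b H xs ≡ H (toℕ (opposite p))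
afterRun-cases b H [] = inj₁ refl
afterRun-cases {ℕ.suc n} b H (x ∷ xs) with x Bool.≟ b
... | no x≢b =
  inj₂ (zero , (λ _ ()) , Bool.¬-not x≢b , cong H (sym (Fin.toℕ-fromℕ n)))
... | yes refl with afterRun-cases b H xs
...   | inj₁ ≡0 = inj₁ ≡0
...   | inj₂ (p , below , xsp , ≡H) = inj₂ (suc p , constantBelow-∷ below , xsp ,
  trans ≡H (cong H (sym (Fin.toℕ-inject₁ (opposite p)))))

sumVectors : ∀ n → (Vec 𝔽₂ n → ℕ) → ℕ
sumVectors n f = sum (List.map f (binaryVectors n))

sumVectors-suc : ∀ n (f : Vec 𝔽₂ (ℕ.suc n) → ℕ) →
  sumVectors (ℕ.suc n) f ≡ sumVectors n (f ∘ (0# ∷_)) ℕ.+ sumVectors n (f ∘ (1# ∷_))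
sumVectors-suc n f = begin
  sum (List.map f (List.map (0# ∷_) V ++ List.map (1# ∷_) V))
    ≡⟨ cong sum (List.map-++ f (List.map (0# ∷_) V) _) ⟩
  sum (List.map f (List.map (0# ∷_) V) ++ List.map f (List.map (1# ∷_) V))
    ≡⟨ sum-++ (List.map f (List.map (0# ∷_) V)) _ ⟩
  sum (List.map f (List.map (0# ∷_) V)) ℕ.+ sum (List.map f (List.map (1# ∷_) V))
    ≡⟨ cong₂ (λ xs ys → sum xs ℕ.+ sum ys) (List.map-∘ V) (List.map-∘ V) ⟨
  sumVectors n (f ∘ (0# ∷_)) ℕ.+ sumVectors n (f ∘ (1# ∷_)) ∎
  where
  open ≡-Reasoning
  V = binaryVectors n

sumVectors-const : ∀ n k → sumVectors n (λ _ → k) ≡ 2 ℕ.^ n ℕ.* k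
sumVectors-const ℕ.zero    k = refl
sumVectors-const (ℕ.suc n) k = trans (sumVectors-suc n _)
  (trans (cong₂ ℕ._+_ (sumVectors-const n k) (sumVectors-const n k))
    (double (2 ℕ.^ n) k))
  where
  double : ∀ q k → q ℕ.* k ℕ.+ q ℕ.* k ≡ 2 ℕ.* q ℕ.* k
  double = solve-∀

-- The j entries after the first change are free, so `H j` occurs 2^j times. In the induction, the
-- half starting with `not b` gives the top term and the other half continues the run.
sumVectors-afterRun : ∀ n b H →
  sumVectors n (afterRun b H) ≡ sum (List.applyDownFrom (λ j → 2 ℕ.^ j ℕ.* H j) n)
sumVectors-afterRun ℕ.zero    b  H = refl
sumVectors-afterRun (ℕ.suc n) false H = trans (sumVectors-suc n _)
  (trans (ℕ.+-comm (sumVectors n (afterRun 0# H)) _)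
    (cong₂ ℕ._+_ (sumVectors-const n (H n)) (sumVectors-afterRun n 0# H)))
sumVectors-afterRun (ℕ.suc n) true H = trans (sumVectors-suc n _)
  (cong₂ ℕ._+_ (sumVectors-const n (H n)) (sumVectors-afterRun n 1# H))

sumVectors-+-≤ : ∀ n {f g h : Vec 𝔽₂ n → ℕ} → (∀ xs → f xs ℕ.+ g xs ℕ.≤ h xs) →
  sumVectors n f ℕ.+ sumVectors n g ℕ.≤ sumVectors n h
sumVectors-+-≤ n {f} {g} {h} f+g≤h = go (binaryVectors n)
  where
  go : ∀ V → sum (List.map f V) ℕ.+ sum (List.map g V) ℕ.≤ sum (List.map h V)
  go List.[]      = ℕ.z≤n
  go (xs List.∷ V) = ℕ.≤-trans
    (ℕ.≤-reflexive (interchange (f xs) _ (g xs) _))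
    (ℕ.+-mono-≤ (f+g≤h xs) (go V))

-- The gain of a single vector.

-- Bounds for L(s) and L(s^rev), where s has length 1 + n and its initial run of
-- b's is followed by 1 + j entries.
lower : ℕ → 𝔽₂ → ℕ → ℕ
lower n false j = ℕ.suc (n ℕ.∸ j)
lower n true j = n ℕ.∸ j

upper : 𝔽₂ → ℕ → ℕ
upper false j = ℕ.suc j
upper true j = ℕ.suc (ℕ.suc j)

-- Prepending b moves the first change to index p + 1, which equals `n ∸ toℕ (opposite p)`; the run
-- bounds apply at that index.
lower-linearComplexity : ∀ b (xs : Vec 𝔽₂ n) p → ConstantBelow b (toℕ p) xs → lookup xs p ≡ not b →
  lower n b (toℕ (opposite p)) ℕ.≤ linearComplexity (b ∷ xs)
lower-linearComplexity {n} b xs p below xsp = bound b below xsp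
  where
  n∸p′ : n ℕ.∸ toℕ (opposite p) ≡ ℕ.suc (toℕ p)
  n∸p′ = trans (cong (n ℕ.∸_) (Fin.opposite-prop p)) (ℕ.m∸[m∸n]≡n (Fin.toℕ<n p))

  bound : ∀ b → ConstantBelow b (toℕ p) xs → lookup xs p ≡ not b →
    lower n b (toℕ (opposite p)) ℕ.≤ linearComplexity (b ∷ xs)
  bound false below xsp rewrite n∸p′ = run-0-recurrence (0# ∷ xs) (suc p)
    (constantBelow-∷ below) xsp (hasRecurrence-linearComplexity (0# ∷ xs))
  bound true below xsp rewrite n∸p′ = run-1-recurrence (1# ∷ xs) (suc p)
    (constantBelow-∷ below) xsp (hasRecurrence-linearComplexity (1# ∷ xs))

linearComplexity-reverse-upper : ∀ b (xs : Vec 𝔽₂ n) p → ConstantBelow b (toℕ p) xs →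
  linearComplexity (reverse (b ∷ xs)) ℕ.≤ upper b (toℕ (opposite p))
linearComplexity-reverse-upper {n} b xs p below = bound b
  (subst (λ m → ConstantFrom b (ℕ.suc m) (reverse (b ∷ xs))) (Fin.toℕ-inject₁ (opposite p))
    (reverse-constant (b ∷ xs) (suc p) (constantBelow-∷ below)))
  where
  bound : ∀ b → ConstantFrom b (ℕ.suc (toℕ (opposite p))) (reverse (b ∷ xs)) →
    linearComplexity (reverse (b ∷ xs)) ℕ.≤ upper b (toℕ (opposite p))
  bound false from = linearComplexity-≤ (reverse (0# ∷ xs)) (tail-0-recurrence (reverse (0# ∷ xs)) _ from)
  bound true from = linearComplexity-≤ (reverse (1# ∷ xs)) (tail-1-recurrence (reverse (1# ∷ xs)) _ from)

-- Truncated to 0 when the two complexity bounds do not separate.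
gap : ℕ → 𝔽₂ → ℕ → ℕ
gap n b j = 2 ℕ.^ lower n b j ℕ.∸ 2 ℕ.^ upper b j

-- If m ≤ u, replacing v by the smaller m can only enlarge the difference, and m + (u - m) = u. If u
-- ≤ m ≤ v, the difference truncates to 0.
m+[u∸v]≤n : ∀ {m n u v} → m ℕ.≤ n → m ℕ.≤ v → u ℕ.≤ n → m ℕ.+ (u ℕ.∸ v) ℕ.≤ n
m+[u∸v]≤n {m} {n} {u} {v} m≤n m≤v u≤n with ℕ.≤-total m u
... | inj₁ m≤u = begin
  m ℕ.+ (u ℕ.∸ v) ≤⟨ ℕ.+-monoʳ-≤ m (ℕ.∸-monoʳ-≤ u m≤v) ⟩
  m ℕ.+ (u ℕ.∸ m) ≡⟨ ℕ.m+[n∸m]≡n m≤u ⟩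
  u               ≤⟨ u≤n ⟩
  n               ∎
  where open ℕ.≤-Reasoning
... | inj₂ u≤m rewrite ℕ.m≤n⇒m∸n≡0 (ℕ.≤-trans u≤m m≤v) | ℕ.+-identityʳ m = m≤n

-- The minimum is at most L(s), which suffices without a change after the run, and at most the upper
-- bound for the reverse, while L(s) is at least the lower bound.
exp-symLinearComplexity-gap : ∀ b (xs : Vec 𝔽₂ n) →
  2 ℕ.^ symLinearComplexity (b ∷ xs) ℕ.+ afterRun b (gap n b) xs ℕ.≤ 2 ℕ.^ linearComplexity (b ∷ xs)
exp-symLinearComplexity-gap {n} b xs with afterRun-cases b (gap n b) xs
... | inj₁ ≡0 rewrite ≡0 | ℕ.+-identityʳ (2 ℕ.^ symLinearComplexity (b ∷ xs)) =
  ℕ.^-monoʳ-≤ 2 (ℕ.m⊓n≤m (linearComplexity (b ∷ xs)) _)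
... | inj₂ (p , below , xsp , ≡gap) rewrite ≡gap = m+[u∸v]≤n
  (ℕ.^-monoʳ-≤ 2 (ℕ.m⊓n≤m lc _))
  (ℕ.^-monoʳ-≤ 2 (ℕ.≤-trans (ℕ.m⊓n≤n lc _) (linearComplexity-reverse-upper b xs p below)))
  (ℕ.^-monoʳ-≤ 2 (lower-linearComplexity b xs p below xsp))
  where
  lc = linearComplexity (b ∷ xs)

-- Lower bounds for the weighted sums of gaps.

-- Moving the subtracted power to the other side keeps the inequality valid even where the gap
-- truncates to 0.
exp-*-gap : ∀ n b j →
  2 ℕ.^ j ℕ.* 2 ℕ.^ lower n b j ℕ.≤ 2 ℕ.^ j ℕ.* gap n b j ℕ.+ 2 ℕ.^ j ℕ.* 2 ℕ.^ upper b j
exp-*-gap n b j = begin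
  2 ℕ.^ j ℕ.* 2 ℕ.^ lower n b j
    ≤⟨ ℕ.*-monoʳ-≤ (2 ℕ.^ j) (ℕ.m≤n+m∸n (2 ℕ.^ lower n b j) (2 ℕ.^ upper b j)) ⟩
  2 ℕ.^ j ℕ.* (2 ℕ.^ upper b j ℕ.+ gap n b j)
    ≡⟨ rearrange (2 ℕ.^ j) (2 ℕ.^ upper b j) (gap n b j) ⟩
  2 ℕ.^ j ℕ.* gap n b j ℕ.+ 2 ℕ.^ j ℕ.* 2 ℕ.^ upper b j ∎
  where
  open ℕ.≤-Reasoning
  rearrange : ∀ q u g → q ℕ.* (u ℕ.+ g) ≡ q ℕ.* g ℕ.+ q ℕ.* u
  rearrange = solve-∀

exp-*-exp-∸ : ∀ {j n} → j ℕ.≤ n → 2 ℕ.^ j ℕ.* 2 ℕ.^ (n ℕ.∸ j) ≡ 2 ℕ.^ n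
exp-*-exp-∸ {j} {n} j≤n = trans (sym (ℕ.^-distribˡ-+-* 2 j (n ℕ.∸ j)))
  (cong (2 ℕ.^_) (ℕ.m+[n∸m]≡n j≤n))

-- The number 2^j of vectors cancels the decay of 2^(n-j+1), so the main term 2^(n+1) is the same
-- for every j; the error is 2 * 4^j.
exp-gap-0 : ∀ {j n} → j ℕ.≤ n →
  2 ℕ.* 2 ℕ.^ n ℕ.≤ 2 ℕ.^ j ℕ.* gap n 0# j ℕ.+ 2 ℕ.* (2 ℕ.^ j ℕ.* 2 ℕ.^ j)
exp-gap-0 {j} {n} j≤n = begin
  2 ℕ.* 2 ℕ.^ n                               ≡⟨ cong (2 ℕ.*_) (exp-*-exp-∸ j≤n) ⟨
  2 ℕ.* (2 ℕ.^ j ℕ.* 2 ℕ.^ (n ℕ.∸ j))         ≡⟨ swap (2 ℕ.^ j) _ ⟩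
  2 ℕ.^ j ℕ.* 2 ℕ.^ lower n 0# j              ≤⟨ exp-*-gap n 0# j ⟩
  2 ℕ.^ j ℕ.* gap n 0# j ℕ.+ 2 ℕ.^ j ℕ.* (2 ℕ.* 2 ℕ.^ j)
    ≡⟨ cong (2 ℕ.^ j ℕ.* gap n 0# j ℕ.+_) (swap (2 ℕ.^ j) _) ⟨
  2 ℕ.^ j ℕ.* gap n 0# j ℕ.+ 2 ℕ.* (2 ℕ.^ j ℕ.* 2 ℕ.^ j) ∎
  where
  open ℕ.≤-Reasoning
  swap : ∀ q r → 2 ℕ.* (q ℕ.* r) ≡ q ℕ.* (2 ℕ.* r)
  swap = solve-∀

-- The lower bound is one less than for zeros and the upper bound one more: the main term halves and
-- the error doubles.
exp-gap-1 : ∀ {j n} → j ℕ.≤ n →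
  2 ℕ.^ n ℕ.≤ 2 ℕ.^ j ℕ.* gap n 1# j ℕ.+ 4 ℕ.* (2 ℕ.^ j ℕ.* 2 ℕ.^ j)
exp-gap-1 {j} {n} j≤n = begin
  2 ℕ.^ n                                     ≡⟨ exp-*-exp-∸ j≤n ⟨
  2 ℕ.^ j ℕ.* 2 ℕ.^ lower n 1# j              ≤⟨ exp-*-gap n 1# j ⟩
  2 ℕ.^ j ℕ.* gap n 1# j ℕ.+ 2 ℕ.^ j ℕ.* (2 ℕ.* (2 ℕ.* 2 ℕ.^ j))
    ≡⟨ cong (2 ℕ.^ j ℕ.* gap n 1# j ℕ.+_) (swap (2 ℕ.^ j) _) ⟨
  2 ℕ.^ j ℕ.* gap n 1# j ℕ.+ 4 ℕ.* (2 ℕ.^ j ℕ.* 2 ℕ.^ j) ∎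
  where
  open ℕ.≤-Reasoning
  swap : ∀ q r → 4 ℕ.* (q ℕ.* r) ≡ q ℕ.* (2 ℕ.* (2 ℕ.* r))
  swap = solve-∀

sum-applyDownFrom-mono : ∀ F {m n} → m ℕ.≤ n →
  sum (List.applyDownFrom F m) ℕ.≤ sum (List.applyDownFrom F n)
sum-applyDownFrom-mono F {m} m≤n = go (ℕ.≤⇒≤′ m≤n)
  where
  go : ∀ {n} → m ℕ.≤′ n → sum (List.applyDownFrom F m) ℕ.≤ sum (List.applyDownFrom F n)
  go ℕ.≤′-refl = ℕ.≤-refl
  go (ℕ.≤′-step {n} m≤′n) = ℕ.≤-trans (go m≤′n) (ℕ.m≤n+m _ (F n))

-- The errors grow by a factor 4, so a single term Y 4^k absorbs all earlier ones: the induction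
-- step needs only 2 Y 4^k ≤ Y 4^(k+1).
sum-applyDownFrom-geometric : ∀ F K Y k →
  (∀ {j} → j ℕ.< k → K ℕ.≤ F j ℕ.+ Y ℕ.* (2 ℕ.^ j ℕ.* 2 ℕ.^ j)) →
  k ℕ.* K ℕ.≤ sum (List.applyDownFrom F k) ℕ.+ Y ℕ.* (2 ℕ.^ k ℕ.* 2 ℕ.^ k)
sum-applyDownFrom-geometric F K Y ℕ.zero    _ = ℕ.z≤n
sum-applyDownFrom-geometric F K Y (ℕ.suc k) bound = begin
  K ℕ.+ k ℕ.* K
    ≤⟨ ℕ.+-mono-≤ (bound (ℕ.n<1+n k))
         (sum-applyDownFrom-geometric F K Y k (bound ∘ ℕ.m<n⇒m<1+n)) ⟩
  (F k ℕ.+ Y ℕ.* (q ℕ.* q)) ℕ.+ (S ℕ.+ Y ℕ.* (q ℕ.* q))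
    ≤⟨ ℕ.m≤m+n _ (2 ℕ.* (Y ℕ.* (q ℕ.* q))) ⟩
  (F k ℕ.+ Y ℕ.* (q ℕ.* q)) ℕ.+ (S ℕ.+ Y ℕ.* (q ℕ.* q)) ℕ.+ 2 ℕ.* (Y ℕ.* (q ℕ.* q))
    ≡⟨ collect (F k) S Y q ⟩
  F k ℕ.+ S ℕ.+ Y ℕ.* ((2 ℕ.* q) ℕ.* (2 ℕ.* q)) ∎
  where
  open ℕ.≤-Reasoning
  q = 2 ℕ.^ k
  S = sum (List.applyDownFrom F k)
  collect : ∀ f S Y q → (f ℕ.+ Y ℕ.* (q ℕ.* q)) ℕ.+ (S ℕ.+ Y ℕ.* (q ℕ.* q)) ℕ.+ 2 ℕ.* (Y ℕ.* (q ℕ.* q))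
    ≡ f ℕ.+ S ℕ.+ Y ℕ.* ((2 ℕ.* q) ℕ.* (2 ℕ.* q))
  collect = solve-∀

gapSum : ℕ → 𝔽₂ → ℕ
gapSum n b = sum (List.applyDownFrom (λ j → 2 ℕ.^ j ℕ.* gap n b j) n)

-- For j ≥ n/2 the error term Y 4^j may exceed K, so only j < ⌊n/2⌋ is used.
gapSum-≥ : ∀ n b K Y → (∀ {j} → j ℕ.≤ n → K ℕ.≤ 2 ℕ.^ j ℕ.* gap n b j ℕ.+ Y ℕ.* (2 ℕ.^ j ℕ.* 2 ℕ.^ j)) →
  ℕ.⌊ n /2⌋ ℕ.* K ℕ.≤ gapSum n b ℕ.+ Y ℕ.* 2 ℕ.^ n
gapSum-≥ n b K Y bound = ℕ.≤-trans
  (sum-applyDownFrom-geometric _ K Y h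
    (λ j<h → bound (ℕ.≤-trans (ℕ.<⇒≤ j<h) (ℕ.⌊n/2⌋≤n n))))
  (ℕ.+-mono-≤ (sum-applyDownFrom-mono _ (ℕ.⌊n/2⌋≤n n)) (ℕ.*-monoʳ-≤ Y 4^h≤2^n))
  where
  h = ℕ.⌊ n /2⌋
  h+h≤n : h ℕ.+ h ℕ.≤ n
  h+h≤n = ℕ.≤-trans (ℕ.+-monoʳ-≤ h (ℕ.⌊n/2⌋≤⌈n/2⌉ n)) (ℕ.≤-reflexive (ℕ.⌊n/2⌋+⌈n/2⌉≡n n))
  -- This keeps the total error at Y 2^n, which is O(1) after division by 2^(n+1).
  4^h≤2^n : 2 ℕ.^ h ℕ.* 2 ℕ.^ h ℕ.≤ 2 ℕ.^ n
  4^h≤2^n = ℕ.≤-trans (ℕ.≤-reflexive (sym (ℕ.^-distribˡ-+-* 2 h h))) (ℕ.^-monoʳ-≤ 2 h+h≤n)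

n≤1+2⌊n/2⌋ : ∀ n → n ℕ.≤ ℕ.suc (2 ℕ.* ℕ.⌊ n /2⌋)
n≤1+2⌊n/2⌋ n = begin
  n                              ≡⟨ ℕ.⌊n/2⌋+⌈n/2⌉≡n n ⟨
  -- By definition `⌈ n /2⌉` is `⌊ suc n /2⌋`, and `⌈ suc n /2⌉` reduces to `suc h`.
  h ℕ.+ ℕ.⌈ n /2⌉                ≤⟨ ℕ.+-monoʳ-≤ h (ℕ.⌊n/2⌋≤⌈n/2⌉ (ℕ.suc n)) ⟩
  h ℕ.+ ℕ.suc h                  ≡⟨ collect h ⟩
  ℕ.suc (2 ℕ.* h)                ∎
  where
  open ℕ.≤-Reasoning
  h = ℕ.⌊ n /2⌋
  collect : ∀ h → h ℕ.+ ℕ.suc h ≡ ℕ.suc (2 ℕ.* h)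
  collect = solve-∀

-- Comparison of the two sums over all vectors.

expSum expSumSym : ℕ → ℕ
expSum N    = sumVectors N λ s → 2 ℕ.^ linearComplexity s
expSumSym N = sumVectors N λ s → 2 ℕ.^ symLinearComplexity s

-- The first entry determines the symbol b of the run, so the pointwise gain is summed over the
-- remaining n entries separately for each b.
expSumSym+gapSum≤expSum : ∀ n →
  expSumSym (ℕ.suc n) ℕ.+ (gapSum n 0# ℕ.+ gapSum n 1#) ℕ.≤ expSum (ℕ.suc n)
expSumSym+gapSum≤expSum n = begin
  expSumSym (ℕ.suc n) ℕ.+ (gapSum n 0# ℕ.+ gapSum n 1#)
    ≡⟨ cong₂ ℕ._+_ (sumVectors-suc n _) (sym (cong₂ ℕ._+_
         (sumVectors-afterRun n 0# (gap n 0#)) (sumVectors-afterRun n 1# (gap n 1#)))) ⟩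
  (G 0# ℕ.+ G 1#) ℕ.+ (H 0# ℕ.+ H 1#)
    ≡⟨ interchange (G 0#) (G 1#) (H 0#) (H 1#) ⟩
  (G 0# ℕ.+ H 0#) ℕ.+ (G 1# ℕ.+ H 1#)
    ≤⟨ ℕ.+-mono-≤ (sumVectors-+-≤ n (exp-symLinearComplexity-gap 0#))
                  (sumVectors-+-≤ n (exp-symLinearComplexity-gap 1#)) ⟩
  sumVectors n (λ xs → 2 ℕ.^ linearComplexity (0# ∷ xs)) ℕ.+
  sumVectors n (λ xs → 2 ℕ.^ linearComplexity (1# ∷ xs))
    ≡⟨ sumVectors-suc n _ ⟨
  expSum (ℕ.suc n) ∎
  where
  open ℕ.≤-Reasoning
  G H : 𝔽₂ → ℕ
  G b = sumVectors n λ xs → 2 ℕ.^ symLinearComplexity (b ∷ xs)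
  H b = sumVectors n (afterRun b (gap n b))

-- The theorem with the denominators 2^N and 4 cleared. With X = 2^n, bounding N by 2 + 2h costs 12
-- X and the errors of the two gap sums cost 4 (2 + 4) X; together 36 X = 18 * 2^N.
expSumSym-bound : ∀ n → expSumSym (ℕ.suc n) ℕ.* 4 ℕ.+ 3 ℕ.* ℕ.suc n ℕ.* 2 ℕ.^ ℕ.suc n ℕ.≤
  expSum (ℕ.suc n) ℕ.* 4 ℕ.+ 18 ℕ.* 2 ℕ.^ ℕ.suc n
expSumSym-bound n = begin
  G ℕ.* 4 ℕ.+ 3 ℕ.* ℕ.suc n ℕ.* (2 ℕ.* X)
    ≤⟨ ℕ.+-monoʳ-≤ (G ℕ.* 4) (ℕ.*-monoˡ-≤ (2 ℕ.* X) (ℕ.*-monoʳ-≤ 3 (ℕ.s≤s (n≤1+2⌊n/2⌋ n)))) ⟩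
  G ℕ.* 4 ℕ.+ 3 ℕ.* (2 ℕ.+ 2 ℕ.* h) ℕ.* (2 ℕ.* X)
    ≡⟨ expand G h X ⟩
  G ℕ.* 4 ℕ.+ (h ℕ.* (2 ℕ.* X) ℕ.+ h ℕ.* X) ℕ.* 4 ℕ.+ 12 ℕ.* X
    ≤⟨ ℕ.+-monoˡ-≤ (12 ℕ.* X) (ℕ.+-monoʳ-≤ (G ℕ.* 4) (ℕ.*-monoˡ-≤ 4
         (ℕ.+-mono-≤ (gapSum-≥ n 0# (2 ℕ.* X) 2 exp-gap-0) (gapSum-≥ n 1# X 4 exp-gap-1)))) ⟩
  G ℕ.* 4 ℕ.+ ((S₀ ℕ.+ 2 ℕ.* X) ℕ.+ (S₁ ℕ.+ 4 ℕ.* X)) ℕ.* 4 ℕ.+ 12 ℕ.* X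
    ≡⟨ collect G S₀ S₁ X ⟩
  (G ℕ.+ (S₀ ℕ.+ S₁)) ℕ.* 4 ℕ.+ 18 ℕ.* (2 ℕ.* X)
    ≤⟨ ℕ.+-monoˡ-≤ (18 ℕ.* (2 ℕ.* X)) (ℕ.*-monoˡ-≤ 4 (expSumSym+gapSum≤expSum n)) ⟩
  expSum (ℕ.suc n) ℕ.* 4 ℕ.+ 18 ℕ.* (2 ℕ.* X) ∎
  where
  open ℕ.≤-Reasoning
  G = expSumSym (ℕ.suc n)
  X = 2 ℕ.^ n
  h = ℕ.⌊ n /2⌋
  S₀ = gapSum n 0#
  S₁ = gapSum n 1#

  expand : ∀ G h X → G ℕ.* 4 ℕ.+ 3 ℕ.* (2 ℕ.+ 2 ℕ.* h) ℕ.* (2 ℕ.* X) ≡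
    G ℕ.* 4 ℕ.+ (h ℕ.* (2 ℕ.* X) ℕ.+ h ℕ.* X) ℕ.* 4 ℕ.+ 12 ℕ.* X
  expand = solve-∀

  collect : ∀ G S T X → G ℕ.* 4 ℕ.+ ((S ℕ.+ 2 ℕ.* X) ℕ.+ (T ℕ.+ 4 ℕ.* X)) ℕ.* 4 ℕ.+ 12 ℕ.* X ≡
    (G ℕ.+ (S ℕ.+ T)) ℕ.* 4 ℕ.+ 18 ℕ.* (2 ℕ.* X)
  collect = solve-∀

-- Passage from natural numbers to rationals.

toℚᵘ-/ : ∀ i d .{{_ : NonZero d}} → toℚᵘ (i / d) ≃ i ℚᵘ./ d
toℚᵘ-/ i (ℕ.suc d) = ℚ.toℚᵘ-fromℚᵘ (mkℚᵘ i d)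

-- Both sides acquire the common denominator m n among unnormalised rationals, where no reduction to
-- lowest terms interferes and only the numerators are compared.
/-+-/-mono : ∀ a b c d m n .{{_ : NonZero m}} .{{_ : NonZero n}} →
  a ℕ.* n ℕ.+ c ℕ.* m ℕ.≤ b ℕ.* n ℕ.+ d ℕ.* m →
  + a / m + + c / n ≤ + b / m + + d / n
/-+-/-mono a b c d m@(ℕ.suc _) n@(ℕ.suc _) le = ℚ.toℚᵘ-cancel-≤ (begin
  toℚᵘ (+ a / m + + c / n)          ≃⟨ toℚᵘ-/-+-/ a c ⟩
  + (a ℕ.* n ℕ.+ c ℕ.* m) ℚᵘ./ (m ℕ.* n)
    ≤⟨ *≤* (ℤ.*-monoʳ-≤-nonNeg (+ (m ℕ.* n)) (+≤+ le)) ⟩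
  + (b ℕ.* n ℕ.+ d ℕ.* m) ℚᵘ./ (m ℕ.* n) ≃⟨ toℚᵘ-/-+-/ b d ⟨
  toℚᵘ (+ b / m + + d / n)          ∎)
  where
  open ℚᵘ.≤-Reasoning
  toℚᵘ-/-+-/ : ∀ a c → toℚᵘ (+ a / m + + c / n) ≃ + (a ℕ.* n ℕ.+ c ℕ.* m) ℚᵘ./ (m ℕ.* n)
  toℚᵘ-/-+-/ a c = begin-equality
    toℚᵘ (+ a / m + + c / n)          ≃⟨ ℚ.toℚᵘ-homo-+ (+ a / m) (+ c / n) ⟩
    toℚᵘ (+ a / m) ℚᵘ.+ toℚᵘ (+ c / n) ≃⟨ ℚᵘ.+-cong (toℚᵘ-/ (+ a) m) (toℚᵘ-/ (+ c) n) ⟩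
    (+ a ℤ.* + n ℤ.+ + c ℤ.* + m) ℚᵘ./ (m ℕ.* n)
      ≡⟨ cong (ℚᵘ._/ (m ℕ.* n)) (trans
           (cong₂ ℤ._+_ (sym (ℤ.pos-* a n)) (sym (ℤ.pos-* c m)))
           (sym (ℤ.pos-+ (a ℕ.* n) (c ℕ.* m)))) ⟩
    + (a ℕ.* n ℕ.+ c ℕ.* m) ℚᵘ./ (m ℕ.* n) ∎

p+r≤q+s⇒p≤q-r+s : ∀ p q r s → p + r ≤ q + s → p ≤ q - r + s
p+r≤q+s⇒p≤q-r+s p q r s le = begin
  p               ≡⟨ //-rightDividesʳ r p ⟨
  (p + r) - r     ≤⟨ ℚ.+-monoˡ-≤ (ℚ.- r) le ⟩
  (q + s) - r     ≡⟨ xy∙z≈xz∙y q s (ℚ.- r) ⟩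
  q - r + s       ∎
  where
  open ℚ.≤-Reasoning

proposition3 : Σ[ C ∈ ℚ ] ((N : ℕ) → .{{_ : NonZero N}} →
    E-lin-exp-sym N ≤ E-lin-exp N - (+ (3 ℕ.* N)) / 4 + C)
proposition3 = + 18 / 4 , λ where
  N@(ℕ.suc n) → p+r≤q+s⇒p≤q-r+s (E-lin-exp-sym N) (E-lin-exp N) (+ (3 ℕ.* N) / 4) (+ 18 / 4)
    (/-+-/-mono (expSumSym N) (expSum N) (3 ℕ.* N) 18 (2 ℕ.^ N) 4 {{ℕ.m^n≢0 2 N}}
      (expSumSym-bound n))
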